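{- For every admissible finite simple graph $G$, $\mathrm{Maj}'(G)\le 8$.
   Context: Graphs are finite, simple and undirected. Two distinct edges are adjacent if they share an endpoint. An edge-coloring $c:E\to C$ (not necessarily proper) of a graph $G=(V,E)$ is a strong majority edge-coloring if for every edge $e\in E$ and every color $\alpha\in C$, at most half of the edges adjacent to $e$ have color $\alpha$ (i.e., no color $\alpha$ occurs on more edges adjacent to $e$ than the other colors together). A graph is admissible if it has no vertex of degree $1$ adjacent to a vertex of degree $2$; exactly the admissible graphs admit a strong majority edge-coloring. The strong majority index $\mathrm{Maj}'(G)$ of an admissible graph $G$ is the least number of colors in a strong majority edge-coloring of $G$. -}

module Defs where

open import Data.Nat using (ℕ; zero; suc; _+_; _*_; _≤_; _<ᵇ_; _≡ᵇ_)
open import Data.Bool using (Bool; true; false; _∧_; _∨_; not; if_then_else_; T)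
open import Data.Fin using (Fin; toℕ)
open import Data.List using (List; []; _∷_; allFin; cartesianProduct)
open import Data.Product using (_×_; _,_; Σ-syntax)
open import Data.Empty using (⊥)
open import Relation.Binary.PropositionalEquality using (_≡_)

record Graph (n : ℕ) : Set where
  field
    adj    : Fin n → Fin n → Bool
    sym    : ∀ u v → adj u v ≡ adj v u
    irrefl : ∀ v → adj v v ≡ false
open Graph public

_==_ : ∀ {n} → Fin n → Fin n → Bool
u == v = toℕ u ≡ᵇ toℕ v

countB : ∀ {A : Set} → (A → Bool) → List A → ℕ
countB p [] = 0
countB p (x ∷ xs) = if p x then suc (countB p xs) else countB p xs

deg : ∀ {n} → Graph n → Fin n → ℕ
deg G v = countB (adj G v) (allFin _)

Admissible : ∀ {n} → Graph n → Set
Admissible {n} G = ∀ (u v : Fin n) → T (adj G u v) → deg G u ≡ 1 → deg G v ≡ 2 → ⊥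

-- Each edge {u,v} is represented exactly once, by the ordered pair (u , v) with u < v.
isEdge : ∀ {n} → Graph n → Fin n × Fin n → Bool
isEdge G (u , v) = (toℕ u <ᵇ toℕ v) ∧ adj G u v

adjacentTo : ∀ {n} → Fin n × Fin n → Fin n × Fin n → Bool
adjacentTo (a , b) (u , v) =
  not ((u == a) ∧ (v == b)) ∧ ((u == a) ∨ (u == b) ∨ (v == a) ∨ (v == b))

pairs : (n : ℕ) → List (Fin n × Fin n)
pairs n = cartesianProduct (allFin n) (allFin n)

-- An edge-coloring with colors Fin k: the edge {u,v} (u < v) gets colour c u v;
-- values of c at other pairs are irrelevant.
EdgeColoring : ℕ → ℕ → Set
EdgeColoring n k = Fin n → Fin n → Fin k

nAdj : ∀ {n} → Graph n → Fin n × Fin n → ℕ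
nAdj {n} G e = countB (λ f → isEdge G f ∧ adjacentTo e f) (pairs n)

nAdjCol : ∀ {n k} → Graph n → EdgeColoring n k → Fin n × Fin n → Fin k → ℕ
nAdjCol {n} G c e α =
  countB (λ { (u , v) → isEdge G (u , v) ∧ adjacentTo e (u , v) ∧ (c u v == α) }) (pairs n)

StrongMajority : ∀ {n k} → Graph n → EdgeColoring n k → Set
StrongMajority {n} {k} G c =
  ∀ (a b : Fin n) → T (isEdge G (a , b)) → ∀ (α : Fin k) →
    2 * nAdjCol G c (a , b) α ≤ nAdj G (a , b)

MajAtMost : ∀ {n} → Graph n → ℕ → Set
MajAtMost {n} G k = Σ[ c ∈ EdgeColoring n k ] StrongMajority G c

{-# OPTIONS --safe #-}
module Submission where

{- Colour the edges greedily. Call a colour full at v when it occurs there on about half of the edges at v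
   (`cap v` times), and forbid full colours; moreover, for an edge ay with deg a + deg y ≤ 5, forbid equal
   colours on the first and last edge of any path b - a - y - z. The only obstruction to bounding the two
   ends of an edge separately is an end of degree 2, whose other edge contributes a colour on its own, so a
   vertex with a neighbour of degree 2 gets a slightly smaller cap.

   The edges without an end of degree 2 come first: then at most 3 colours are full at either end and no
   path condition applies, so at most 6 colours are forbidden. For the remaining edges at most 3 colours are
   forbidden by an end of degree 2 and at most 4 by the other end. Hence one of 8 colours is always free. -}

open import Defs renaming (sym to adj-sym; irrefl to adj-irrefl)
open import Data.Nat using (ℕ; zero; suc; _+_; _*_; _∸_; _⊔_; _⊓_; ⌊_/2⌋; ⌈_/2⌉; >-nonZero; _≤_; _<_; _≤ᵇ_; _<ᵇ_; _≡ᵇ_; z≤n; s≤s; s≤s⁻¹; _≤?_)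
import Data.Nat as ℕ
open import Data.Nat.Properties hiding (_≟_)
open import Data.Bool using (Bool; true; false; _∧_; _∨_; not; if_then_else_; T)
open import Data.Bool.Properties using (T?; ∧-comm; ∨-comm; ∧-zeroʳ; T-∧; T-∨; T-≡)
open import Data.Fin using (Fin; zero; suc; toℕ)
open import Data.Fin.Properties using (toℕ-injective; _≟_)
open import Data.List using (List; []; _∷_; allFin; cartesianProduct; tabulate; map; _++_)
open import Data.List.Membership.Propositional using (_∈_)
open import Data.List.Membership.Propositional.Properties using (∈-allFin; ∈-cartesianProduct⁺)
open import Data.List.Relation.Unary.Any using (here; there)
open import Data.Maybe using (Maybe; just; nothing; is-just; fromMaybe)
open import Data.Maybe.Properties using (just-injective)
open import Data.Product using (_×_; _,_; ∃-syntax; proj₁; proj₂)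
open import Data.Sum using (_⊎_; inj₁; inj₂)
open import Data.Empty using (⊥-elim)
open import Data.Unit using (tt)
open import Function using (_∘_; id; Equivalence; case_of_)
open import Relation.Nullary using (¬_; yes; no)
open import Relation.Binary.PropositionalEquality using (_≡_; _≢_; refl; sym; trans; cong; cong₂; subst; subst₂; module ≡-Reasoning)
open import Algebra.Properties.Semiring.Sum +-*-semiring using (sum; sum-cong-≗; ∑-distrib-+; ∑-comm; *-distribˡ-sum; *-distribʳ-sum; sum-replicate-zero; sum-syntax)

-- Indicators of Booleans and finite sums.

infix 8 ⟦_⟧
⟦_⟧ : Bool → ℕ
⟦ true  ⟧ = 1
⟦ false ⟧ = 0

⟦⟧-mono : ∀ {b c} → (T b → T c) → ⟦ b ⟧ ≤ ⟦ c ⟧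
⟦⟧-mono {false}         h = z≤n
⟦⟧-mono {true}  {true}  h = ≤-refl
⟦⟧-mono {true}  {false} h = ⊥-elim (h tt)

⟦∨⟧ : ∀ b c → ⟦ b ∨ c ⟧ ≤ ⟦ b ⟧ + ⟦ c ⟧
⟦∨⟧ true  c = s≤s z≤n
⟦∨⟧ false c = ≤-refl

≡-T : ∀ {b} → b ≡ true → T b
≡-T = Equivalence.from T-≡

T-∧⁻ : ∀ {b c} → T (b ∧ c) → T b × T c
T-∧⁻ = Equivalence.to T-∧

T-∧⁺ : ∀ {b c} → T b → T c → T (b ∧ c)
T-∧⁺ p q = Equivalence.from T-∧ (p , q)

T-not⁻ : ∀ {b} → T (not b) → ¬ T b
T-not⁻ {false} _ ()

T-not⁺ : ∀ {b} → ¬ T b → T (not b)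
T-not⁺ {false} _ = tt
T-not⁺ {true}  h = h tt

==⇒≡ : ∀ {n} {u v : Fin n} → T (u == v) → u ≡ v
==⇒≡ {u = u} {v} = toℕ-injective ∘ ≡ᵇ⇒≡ (toℕ u) (toℕ v)

==-refl : ∀ {n} (u : Fin n) → T (u == u)
==-refl u = ≡⇒≡ᵇ (toℕ u) (toℕ u) refl

≡⇒== : ∀ {n} {u v : Fin n} → u ≡ v → T (u == v)
≡⇒== {u = u} refl = ==-refl u

≢⇒≠ : ∀ {n} {u v : Fin n} → u ≢ v → T (not (u == v))
≢⇒≠ u≢v = T-not⁺ (u≢v ∘ ==⇒≡)

≠⇒≢ : ∀ {n} {u v : Fin n} → T (not (u == v)) → u ≢ v
≠⇒≢ h = T-not⁻ h ∘ ≡⇒==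

sum-mono : ∀ {n} {f g : Fin n → ℕ} → (∀ i → f i ≤ g i) → sum f ≤ sum g
sum-mono {zero}  f≤g = z≤n
sum-mono {suc n} f≤g = +-mono-≤ (f≤g zero) (sum-mono (f≤g ∘ suc))

sum-zero : ∀ {n} {f : Fin n → ℕ} → (∀ i → f i ≡ 0) → sum f ≡ 0
sum-zero {n} f≡0 = trans (sum-cong-≗ f≡0) (sum-replicate-zero n)

term≤sum : ∀ {n} (f : Fin n → ℕ) i → f i ≤ sum f
term≤sum f zero    = m≤m+n (f zero) _
term≤sum f (suc i) = ≤-trans (term≤sum (f ∘ suc) i) (m≤n+m _ (f zero))

sum-witness : ∀ {n} (p : Fin n → Bool) → 1 ≤ sum (⟦_⟧ ∘ p) → ∃[ i ] T (p i)
sum-witness {suc n} p h with p zero in eq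
... | true  = zero , ≡-T eq
... | false = let i , pi = sum-witness (p ∘ suc) h in suc i , pi

sum-avoid : ∀ {n} (p : Fin n → Bool) → sum (⟦_⟧ ∘ p) < n → ∃[ i ] ¬ T (p i)
sum-avoid {suc n} p h with p zero in eq
... | false = zero , subst T eq
... | true  = let i , ¬pi = sum-avoid (p ∘ suc) (s≤s⁻¹ h) in suc i , ¬pi

sum-point : ∀ {n} (a : Fin n) (f : Fin n → ℕ) → ∑[ u < n ] (⟦ u == a ⟧ * f u) ≡ f a
sum-point {suc n} zero    f = trans (cong₂ _+_ (+-identityʳ (f zero)) (sum-zero {n} (λ i → refl))) (+-identityʳ (f zero))
sum-point {suc n} (suc a) f = sum-point a (f ∘ suc)

sum-indicator : ∀ {n} (a : Fin n) → ∑[ u < n ] ⟦ u == a ⟧ ≡ 1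
sum-indicator {n} a = trans (sum-cong-≗ {n} (λ u → sym (*-identityʳ _))) (sum-point a (λ _ → 1))

-- List counts as finite sums, and double sums over pairs.

countB-tabulate : ∀ {A : Set} {n} (p : A → Bool) (f : Fin n → A) →
                  countB p (tabulate f) ≡ sum (⟦_⟧ ∘ p ∘ f)
countB-tabulate {n = zero}  p f = refl
countB-tabulate {n = suc n} p f with p (f zero)
... | true  = cong suc (countB-tabulate p (f ∘ suc))
... | false = countB-tabulate p (f ∘ suc)

countB-++ : ∀ {A : Set} (p : A → Bool) xs ys → countB p (xs ++ ys) ≡ countB p xs + countB p ys
countB-++ p []       ys = refl
countB-++ p (x ∷ xs) ys with p x
... | true  = cong suc (countB-++ p xs ys)
... | false = countB-++ p xs ys

countB-map : ∀ {A B : Set} (p : B → Bool) (f : A → B) xs → countB p (map f xs) ≡ countB (p ∘ f) xs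
countB-map p f []       = refl
countB-map p f (x ∷ xs) with p (f x)
... | true  = cong suc (countB-map p f xs)
... | false = countB-map p f xs

countB-product : ∀ {A : Set} {m n} (p : A × Fin n → Bool) (f : Fin m → A) →
  countB p (cartesianProduct (tabulate f) (allFin n)) ≡ ∑[ i < m ] ∑[ j < n ] ⟦ p (f i , j) ⟧
countB-product {m = zero}  p f = refl
countB-product {m = suc m} {n} p f = begin
  countB p (map (f zero ,_) (allFin n) ++ _)
    ≡⟨ countB-++ p (map (f zero ,_) (allFin n)) _ ⟩
  countB p (map (f zero ,_) (allFin n)) + _
    ≡⟨ cong₂ _+_ (trans (countB-map p (f zero ,_) (allFin n)) (countB-tabulate (p ∘ (f zero ,_)) id)) (countB-product p (f ∘ suc)) ⟩
  _ ∎
  where open ≡-Reasoning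

countB-pairs : ∀ {n} (p : Fin n × Fin n → Bool) → countB p (pairs n) ≡ ∑[ u < n ] ∑[ v < n ] ⟦ p (u , v) ⟧
countB-pairs p = countB-product p id

sum-row : ∀ {m n} (a : Fin m) (g : Fin m → Fin n → ℕ) →
          ∑[ u < m ] ∑[ v < n ] (⟦ u == a ⟧ * g u v) ≡ ∑[ v < n ] g a v
sum-row {m} a g =
  trans (sum-cong-≗ {m} (λ u → sym (*-distribˡ-sum ⟦ u == a ⟧ (g u)))) (sum-point a (sum ∘ g))

sum-column : ∀ {m n} (b : Fin n) (g : Fin m → Fin n → ℕ) →
             ∑[ u < m ] ∑[ v < n ] (⟦ v == b ⟧ * g u v) ≡ ∑[ u < m ] g u b
sum-column {m} b g = sum-cong-≗ {m} (λ u → sum-point b (g u))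

∑∑-distrib-+ : ∀ {m n} (f g : Fin m → Fin n → ℕ) →
  ∑[ u < m ] ∑[ v < n ] (f u v + g u v) ≡ ∑[ u < m ] ∑[ v < n ] f u v + ∑[ u < m ] ∑[ v < n ] g u v
∑∑-distrib-+ {m} f g =
  trans (sum-cong-≗ {m} (λ u → ∑-distrib-+ (f u) (g u))) (∑-distrib-+ (sum ∘ f) (sum ∘ g))

-- Counting the edges adjacent to an edge by their common endpoint.

module _ {n : ℕ} (P : Fin n → Fin n → Bool) (P-sym : ∀ u v → P u v ≡ P v u)
         (P-irrefl : ∀ v → P v v ≡ false) where

  private
    ordered : Fin n → Fin n → Bool
    ordered u v = (toℕ u <ᵇ toℕ v) ∧ P u v

    ordered⇒< : ∀ {u v} → T (ordered u v) → toℕ u < toℕ v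
    ordered⇒< {u} {v} h = <ᵇ⇒< (toℕ u) (toℕ v) (proj₁ (T-∧⁻ h))

    -- For p, q, r, s the tests u = a, u = b, v = a, v = b: an edge uv ≠ ab meets ab in at most one endpoint.
    indicator-split : ∀ x p q r s → ¬ (T p × T q) → ¬ (T r × T s) →
      (T x → ¬ (T p × T r) × ¬ (T q × T s) × ¬ (T q × T r)) →
      ⟦ x ∧ (not (p ∧ s) ∧ (p ∨ q ∨ r ∨ s)) ⟧ ≡
      (⟦ p ⟧ * ⟦ x ∧ not s ⟧ + ⟦ r ⟧ * ⟦ x ∧ not q ⟧) + (⟦ q ⟧ * ⟦ x ∧ not r ⟧ + ⟦ s ⟧ * ⟦ x ∧ not p ⟧)
    indicator-split false p q r s _ _ _ = sym (cong₂ _+_ (cong₂ _+_ (*-zeroʳ ⟦ p ⟧) (*-zeroʳ ⟦ r ⟧)) (cong₂ _+_ (*-zeroʳ ⟦ q ⟧) (*-zeroʳ ⟦ s ⟧)))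
    indicator-split true true  true  r     s     h _ _ = ⊥-elim (h _)
    indicator-split true p     q     true  true  _ h _ = ⊥-elim (h _)
    indicator-split true true  false true  false _ _ h = ⊥-elim (proj₁ (h _) _)
    indicator-split true false true  false true  _ _ h = ⊥-elim (proj₁ (proj₂ (h _)) _)
    indicator-split true false true  true  false _ _ h = ⊥-elim (proj₂ (proj₂ (h _)) _)
    indicator-split true true  false false true  _ _ _ = refl
    indicator-split true true  false false false _ _ _ = refl
    indicator-split true false true  false false _ _ _ = refl
    indicator-split true false false true  false _ _ _ = refl
    indicator-split true false false false true  _ _ _ = refl
    indicator-split true false false false false _ _ _ = refl

    -- An unordered pair is listed in exactly one of its two orders, so one summand always vanishes.
    -- For `a = w` neither order is listed, and irreflexivity of `P` makes the right side 0 as well.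
    unorder : ∀ a w (x : Bool) →
      ⟦ ordered a w ∧ x ⟧ + ⟦ ordered w a ∧ x ⟧ ≡ ⟦ x ∧ P a w ⟧
    unorder a w x rewrite P-sym w a with toℕ a <ᵇ toℕ w in eq₁ | toℕ w <ᵇ toℕ a in eq₂
    ... | true | true = ⊥-elim (<-asym (<ᵇ⇒< (toℕ a) (toℕ w) (≡-T eq₁)) (<ᵇ⇒< (toℕ w) (toℕ a) (≡-T eq₂)))
    ... | true | false = trans (+-identityʳ _) (cong ⟦_⟧ (∧-comm (P a w) x))
    ... | false | true = cong ⟦_⟧ (∧-comm (P a w) x)
    ... | false | false = sym (trans (cong (λ b → ⟦ x ∧ b ⟧) (subst (λ v → P a v ≡ false) a≡w (P-irrefl a))) (cong ⟦_⟧ (∧-zeroʳ x)))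
      where
      a≡w : a ≡ w
      a≡w = toℕ-injective (≤-antisym (≮⇒≥ (λ h → subst T eq₂ (<⇒<ᵇ h))) (≮⇒≥ (λ h → subst T eq₁ (<⇒<ᵇ h))))

  -- Grouping the adjacent edges by the one endpoint they share with `ab` turns a count over ordered
  -- pairs into two sums over neighbours. `P` is left general because it serves both for all edges
  -- and for a single colour class.
  pairs-adjacent : ∀ a b → toℕ a < toℕ b →
    ∑[ u < n ] ∑[ v < n ] ⟦ ((toℕ u <ᵇ toℕ v) ∧ P u v) ∧ adjacentTo (a , b) (u , v) ⟧ ≡
    ∑[ w < n ] ⟦ not (w == b) ∧ P a w ⟧ + ∑[ w < n ] ⟦ not (w == a) ∧ P b w ⟧
  pairs-adjacent a b a<b = begin
    _ ≡⟨ sum-cong-≗ {n} (λ u → sum-cong-≗ {n} (λ v → indicator-split (ordered u v) (u == a) (u == b) (v == a) (v == b)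
           (λ (p , q) → a≢b {u} (==⇒≡ p) (==⇒≡ q)) (λ (r , s) → a≢b {v} (==⇒≡ r) (==⇒≡ s))
           (λ x → (λ (p , r) → same x (==⇒≡ p) (==⇒≡ r)) , (λ (q , s) → same x (==⇒≡ q) (==⇒≡ s)) ,
                  (λ (q , r) → flipped x (==⇒≡ q) (==⇒≡ r))))) ⟩
    _ ≡⟨ ∑∑-distrib-+ {n} {n} (λ u v → ⟦ u == a ⟧ * ⟦ ordered u v ∧ not (v == b) ⟧ + ⟦ v == a ⟧ * ⟦ ordered u v ∧ not (u == b) ⟧) _ ⟩
    _ ≡⟨ cong₂ _+_ (half a b) (half b a) ⟩
    _ ∎
    where
    open ≡-Reasoning
    a≢b : ∀ {w} → w ≡ a → w ≢ b
    a≢b refl refl = <-irrefl refl a<b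
    same : ∀ {u v w} → T (ordered u v) → u ≡ w → v ≢ w
    same h refl refl = <-irrefl refl (ordered⇒< h)
    -- `adjacentTo` removes only the orientation `(a , b)` of the edge itself; the reversed pair is
    -- ruled out by `a < b`.
    flipped : ∀ {u v} → T (ordered u v) → u ≡ b → v ≢ a
    flipped h refl refl = <-asym a<b (ordered⇒< h)
    half : ∀ a b →
      ∑[ u < n ] ∑[ v < n ] (⟦ u == a ⟧ * ⟦ ordered u v ∧ not (v == b) ⟧ + ⟦ v == a ⟧ * ⟦ ordered u v ∧ not (u == b) ⟧)
      ≡ ∑[ w < n ] ⟦ not (w == b) ∧ P a w ⟧
    half a b = begin
      _ ≡⟨ ∑∑-distrib-+ {n} {n} (λ u v → ⟦ u == a ⟧ * ⟦ ordered u v ∧ not (v == b) ⟧) _ ⟩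
      _ ≡⟨ cong₂ _+_ (sum-row {n} {n} a (λ u v → ⟦ ordered u v ∧ not (v == b) ⟧)) (sum-column {n} {n} a (λ u v → ⟦ ordered u v ∧ not (u == b) ⟧)) ⟩
      _ ≡⟨ ∑-distrib-+ {n} (λ w → ⟦ ordered a w ∧ not (w == b) ⟧) (λ w → ⟦ ordered w a ∧ not (w == b) ⟧) ⟨
      _ ≡⟨ sum-cong-≗ {n} (λ w → unorder a w (not (w == b))) ⟩
      _ ∎

-- Arithmetic of the caps and of the number of full colours.

-- h is 1 at a vertex with a neighbour of degree 2, and 0 otherwise.
capacity : ℕ → ℕ → ℕ
capacity d h = 1 ⊔ ⌊ d ∸ suc h /2⌋

2*⌊n/2⌋≤n : ∀ n → 2 * ⌊ n /2⌋ ≤ n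
2*⌊n/2⌋≤n n = begin
  ⌊ n /2⌋ + (⌊ n /2⌋ + 0) ≡⟨ cong (⌊ n /2⌋ +_) (+-identityʳ _) ⟩
  ⌊ n /2⌋ + ⌊ n /2⌋       ≤⟨ +-monoʳ-≤ ⌊ n /2⌋ (⌊n/2⌋≤⌈n/2⌉ n) ⟩
  ⌊ n /2⌋ + ⌈ n /2⌉       ≡⟨ ⌊n/2⌋+⌈n/2⌉≡n n ⟩
  n                       ∎
  where open ≤-Reasoning

n≤1+⌊n/2⌋*2 : ∀ n → n ≤ 1 + ⌊ n /2⌋ * 2
n≤1+⌊n/2⌋*2 zero          = z≤n
n≤1+⌊n/2⌋*2 (suc zero)    = s≤s z≤n
n≤1+⌊n/2⌋*2 (suc (suc n)) = s≤s (s≤s (n≤1+⌊n/2⌋*2 n))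

2*capacity≤ : ∀ d h {x} → 2 ≤ x → d ∸ suc h ≤ x → 2 * capacity d h ≤ x
2*capacity≤ d h {x} 2≤x le = subst (_≤ x) (sym (*-distribˡ-⊔ 2 1 ⌊ d ∸ suc h /2⌋))
  (⊔-lub 2≤x (≤-trans (2*⌊n/2⌋≤n (d ∸ suc h)) le))

-- Strictness matters: an edge has `d ∸ 1` other edges at this end, and the cap must not exceed half
-- of those.
2*capacity< : ∀ {d} h → 3 ≤ d → 2 * capacity d h < d
2*capacity< {suc d} h (s≤s 2≤d) = s≤s (2*capacity≤ (suc d) h 2≤d (m∸n≤m d h))

-- The extra 2 pays for the other edge at a neighbour of degree 2, which may repeat the colour; an
-- edge to such a neighbour has `(d ∸ 1) + 1 = d` adjacent edges.
2+2*capacity≤ : ∀ {d} → 4 ≤ d → 2 + 2 * capacity d 1 ≤ d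
2+2*capacity≤ {suc (suc d)} (s≤s (s≤s 2≤d)) = s≤s (s≤s (2*capacity≤ (suc (suc d)) 1 2≤d ≤-refl))

capacity≤1 : ∀ {d} h → d ≤ 4 → capacity d h ≤ 1
capacity≤1 h d≤4 = ⊔-lub ≤-refl (⌊n/2⌋-mono (∸-mono d≤4 (s≤s z≤n)))

-- The rounding loses at most one, so `x ≤ 1 + 2 * c`. With `N ≥ 4 + t` the product would be at
-- least `(2 + t) + 2 * c`, which exceeds `t + x`.
few-multiples : ∀ {c x N} t → 1 ≤ c → ⌊ x /2⌋ ≤ c → c * N ≤ t + x → N ≤ 3 + t
few-multiples {c} {x} {N} t 1≤c k≤c le = ≮⇒≥ λ N>3+t → <-irrefl refl (begin-strict
  t + (1 + c * 2)      <⟨ s≤s ≤-refl ⟩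
  1 + (t + (1 + c * 2)) ≡⟨ cong suc (+-suc t (c * 2)) ⟩
  (2 + t) + c * 2      ≡⟨ cong (_+ c * 2) (*-identityˡ (2 + t)) ⟨
  1 * (2 + t) + c * 2  ≤⟨ +-monoˡ-≤ (c * 2) (*-monoˡ-≤ (2 + t) 1≤c) ⟩
  c * (2 + t) + c * 2  ≡⟨ *-distribˡ-+ c (2 + t) 2 ⟨
  c * (2 + t + 2)      ≡⟨ cong (c *_) (+-comm (2 + t) 2) ⟩
  c * (4 + t)          ≤⟨ *-monoʳ-≤ c N>3+t ⟩
  c * N                ≤⟨ le ⟩
  t + x                ≤⟨ +-monoʳ-≤ t (n≤1+⌊n/2⌋*2 x) ⟩
  t + (1 + ⌊ x /2⌋ * 2) ≤⟨ +-monoʳ-≤ t (s≤s (*-monoˡ-≤ 2 k≤c)) ⟩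
  t + (1 + c * 2)      ∎)
  where open ≤-Reasoning

-- Meant for the first pass: besides the edge to be coloured, `s` leaves out an edge to a neighbour
-- of degree 2 when `h` is 1, so `s` is at most the number that `capacity` halves.
full≤3 : ∀ {d h N s} → capacity d h * N ≤ s → s + suc h ≤ d → N ≤ 3
full≤3 {d} {h} {N} {s} le s≤ = few-multiples 0 (m≤m⊔n 1 ⌊ d ∸ suc h /2⌋) (m≤n⊔m 1 ⌊ d ∸ suc h /2⌋) (≤-trans le (m+n≤o⇒m≤o∸n s s≤))

-- With only one edge known to be uncoloured, `s` may exceed the halved number by 1, which costs one
-- more colour.
full≤4 : ∀ {d h N s} → h ≤ 1 → capacity d h * N ≤ s → s < d → N ≤ 4
full≤4 {suc d} {h} {N} {s} h≤1 le (s≤s s≤d) = few-multiples 1 (m≤m⊔n 1 ⌊ d ∸ h /2⌋) (m≤n⊔m 1 ⌊ d ∸ h /2⌋) (begin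
  capacity (suc d) h * N ≤⟨ le ⟩
  s                      ≤⟨ s≤d ⟩
  d                      ≤⟨ m≤n+m∸n d 1 ⟩
  1 + (d ∸ 1)            ≤⟨ s≤s (∸-monoʳ-≤ d h≤1) ⟩
  1 + (d ∸ h)            ∎)
  where open ≤-Reasoning

full<deg : ∀ {d h N s} → capacity d h * N ≤ s → s < d → N < d
full<deg {d} {h} {N} le s<d = ≤-<-trans (≤-trans (m≤n*m N (capacity d h) {{>-nonZero (m≤m⊔n 1 ⌊ d ∸ suc h /2⌋)}}) le) s<d

-- For `d` equal to 1, 2, 3 the bound on `M` is 0, 2, 2 and `N` is at most 0, 1, 2, giving totals 0,
-- 3, 4. From `d = 4` on, `M` vanishes and the bound on `N` alone suffices.
side≤4 : ∀ d {N M} → N ≤ 4 → N < d → M ≤ (d ∸ 1) * (4 ∸ d) → N + M ≤ 4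
side≤4 1 N≤4 N<d M≤ = +-mono-≤ (s≤s⁻¹ N<d) (≤-trans M≤ z≤n)
side≤4 2 N≤4 N<d M≤ = ≤-trans (+-mono-≤ (s≤s⁻¹ N<d) M≤) (n≤1+n 3)
side≤4 3 N≤4 N<d M≤ = +-mono-≤ (s≤s⁻¹ N<d) M≤
side≤4 (suc (suc (suc (suc d)))) N≤4 N<d M≤ = +-mono-≤ N≤4 (≤-trans M≤ (≤-reflexive (trans (cong ((3 + d) *_) (0∸n≡0 d)) (*-zeroʳ (3 + d)))))

side≤3 : ∀ {d N M} → d ≡ 2 → N < d → M ≤ (d ∸ 1) * (4 ∸ d) → N + M ≤ 3
side≤3 refl N<2 M≤2 = +-mono-≤ (s≤s⁻¹ N<2) M≤2

-- Colour classes, averaging and the choice of a free colour.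

has : ∀ {k} → Fin k → Maybe (Fin k) → Bool
has α nothing  = false
has α (just β) = α == β

has⇒≡ : ∀ {k} {α : Fin k} {m} → T (has α m) → m ≡ just α
has⇒≡ {m = just β} h = cong just (sym (==⇒≡ h))

≡⇒has : ∀ {k} {α : Fin k} {m} → m ≡ just α → T (has α m)
≡⇒has {α = α} refl = ==-refl α

sum-has : ∀ {k} q (m : Maybe (Fin k)) → ∑[ α < k ] ⟦ q ∧ has α m ⟧ ≡ ⟦ q ∧ is-just m ⟧
sum-has {k} false m    = sum-zero {k} (λ _ → refl)
sum-has {k} true nothing  = sum-zero {k} (λ _ → refl)
sum-has true (just β) = sum-indicator β

-- Markov's inequality: each index that is counted contributes at least `K` to the sum.
many-large : ∀ {k} K (m : Fin k → ℕ) → K * ∑[ α < k ] ⟦ K ≤ᵇ m α ⟧ ≤ sum m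
many-large {k} K m = begin
  K * ∑[ α < k ] ⟦ K ≤ᵇ m α ⟧   ≡⟨ *-distribˡ-sum {k} K (λ α → ⟦ K ≤ᵇ m α ⟧) ⟩
  ∑[ α < k ] (K * ⟦ K ≤ᵇ m α ⟧) ≤⟨ sum-mono pointwise ⟩
  sum m                         ∎
  where
  open ≤-Reasoning
  pointwise : ∀ α → K * ⟦ K ≤ᵇ m α ⟧ ≤ m α
  pointwise α with K ≤ᵇ m α in eq
  ... | true  = ≤-trans (≤-reflexive (*-identityʳ K)) (≤ᵇ⇒≤ K (m α) (≡-T eq))
  ... | false = ≤-trans (≤-reflexive (*-zeroʳ K)) z≤n

⟦⟧≤+ : ∀ {x y z} → (T x → T y ⊎ T z) → ⟦ x ⟧ ≤ ⟦ y ⟧ + ⟦ z ⟧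
⟦⟧≤+ {x} {y} {z} h = ≤-trans (⟦⟧-mono (Equivalence.from T-∨ ∘ h)) (⟦∨⟧ y z)

-- A union bound followed by the pigeonhole principle; the four predicates will be the two reasons
-- to forbid a colour at each of the two ends.
sum-avoid₄ : ∀ {k} (p q r s : Fin k → Bool) →
  (sum (⟦_⟧ ∘ p) + sum (⟦_⟧ ∘ q)) + (sum (⟦_⟧ ∘ r) + sum (⟦_⟧ ∘ s)) < k →
  ∃[ i ] ((¬ T (p i)) × (¬ T (q i))) × ((¬ T (r i)) × (¬ T (s i)))
sum-avoid₄ {k} p q r s few = i , split (p i) (q i) (proj₁ avoided) , split (r i) (s i) (proj₂ avoided)
  where
  sum-∨ : (p q : Fin k → Bool) → ∑[ i < k ] ⟦ p i ∨ q i ⟧ ≤ sum (⟦_⟧ ∘ p) + sum (⟦_⟧ ∘ q)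
  sum-∨ p q = ≤-trans (sum-mono {k} (λ i → ⟦∨⟧ (p i) (q i))) (≤-reflexive (∑-distrib-+ {k} (⟦_⟧ ∘ p) (⟦_⟧ ∘ q)))
  pq rs : Fin k → Bool
  pq i = p i ∨ q i
  rs i = r i ∨ s i
  split : ∀ b c → ¬ T (b ∨ c) → (¬ T b) × (¬ T c)
  split b c h = h ∘ Equivalence.from (T-∨ {b} {c}) ∘ inj₁ , h ∘ Equivalence.from (T-∨ {b} {c}) ∘ inj₂
  available : ∃[ i ] ¬ T (pq i ∨ rs i)
  available = sum-avoid (λ i → pq i ∨ rs i)
    (≤-<-trans (≤-trans (sum-∨ pq rs) (+-mono-≤ (sum-∨ p q) (sum-∨ r s))) few)
  i = proj₁ available
  avoided = split (pq i) (rs i) (proj₂ available)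

⟦⟧-disjoint : ∀ {x y z t} → (T x → ¬ T y) → (T x → ¬ T z) → (T y → ¬ T z) →
              (T x → T t) → (T y → T t) → (T z → T t) → ⟦ x ⟧ + (⟦ y ⟧ + ⟦ z ⟧) ≤ ⟦ t ⟧
⟦⟧-disjoint {true}  {true}  xy _  _  _ _ _ = ⊥-elim (xy _ _)
⟦⟧-disjoint {true}  {false} {true}  _  xz _  _ _ _ = ⊥-elim (xz _ _)
⟦⟧-disjoint {true}  {false} {false} _  _  _  x _ _ = ⟦⟧-mono x
⟦⟧-disjoint {false} {true}  {true}  _  _  yz _ _ _ = ⊥-elim (yz _ _)
⟦⟧-disjoint {false} {true}  {false} _  _  _  _ y _ = ⟦⟧-mono y
⟦⟧-disjoint {false} {false} _  _  _  _ _ z = ⟦⟧-mono z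

¬T⇒0 : ∀ {b} → ¬ T b → ⟦ b ⟧ ≡ 0
¬T⇒0 {false} _ = refl
¬T⇒0 {true}  h = ⊥-elim (h _)

-- Degrees, caps and forbidden colours of a partial colouring.

module _ {n : ℕ} (G : Graph n) where

  private
    V = Fin n
    C = Fin 8

  PartialColoring : Set
  PartialColoring = V → V → Maybe C

  deg-sum : ∀ v → deg G v ≡ ∑[ w < n ] ⟦ adj G v w ⟧
  deg-sum v = countB-tabulate (adj G v) id

  adj⇒≢ : ∀ {u v} → T (adj G u v) → u ≢ v
  adj⇒≢ {u} uv refl = subst T (adj-irrefl G u) uv

  flip-adj : ∀ {u v} → T (adj G u v) → T (adj G v u)
  flip-adj {u} {v} = subst T (adj-sym G u v)

  deg-remove : ∀ {v w} → T (adj G v w) → suc (∑[ z < n ] ⟦ not (z == w) ∧ adj G v z ⟧) ≡ deg G v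
  deg-remove {v} {w} vw = begin
    1 + ∑[ z < n ] ⟦ not (z == w) ∧ adj G v z ⟧
      ≡⟨ cong (_+ ∑[ z < n ] ⟦ not (z == w) ∧ adj G v z ⟧) (sum-indicator w) ⟨
    ∑[ z < n ] ⟦ z == w ⟧ + ∑[ z < n ] ⟦ not (z == w) ∧ adj G v z ⟧
      ≡⟨ ∑-distrib-+ {n} (λ z → ⟦ z == w ⟧) (λ z → ⟦ not (z == w) ∧ adj G v z ⟧) ⟨
    ∑[ z < n ] (⟦ z == w ⟧ + ⟦ not (z == w) ∧ adj G v z ⟧) ≡⟨ sum-cong-≗ {n} pointwise ⟩
    ∑[ z < n ] ⟦ adj G v z ⟧ ≡⟨ deg-sum v ⟨
    deg G v ∎
    where
    open ≡-Reasoning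
    pointwise : ∀ z → ⟦ z == w ⟧ + ⟦ not (z == w) ∧ adj G v z ⟧ ≡ ⟦ adj G v z ⟧
    pointwise z with z == w in eq
    ... | false = refl
    ... | true  = sym (cong ⟦_⟧ (Equivalence.to T-≡ (subst (T ∘ adj G v) (sym (==⇒≡ {u = z} (≡-T eq))) vw)))

  deg≥2 : ∀ {v w z} → T (adj G v w) → T (adj G v z) → z ≢ w → 2 ≤ deg G v
  deg≥2 {v} {w} {z} vw vz z≢w = subst (2 ≤_) (deg-remove vw)
    (s≤s (≤-trans (⟦⟧-mono {true} (λ _ → T-∧⁺ (≢⇒≠ z≢w) vz)) (term≤sum (λ z → ⟦ not (z == w) ∧ adj G v z ⟧) z)))

  deg2-neighbours : V → ℕ
  deg2-neighbours v = ∑[ w < n ] ⟦ adj G v w ∧ (deg G w ≡ᵇ 2) ⟧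

  has-deg2 : V → ℕ
  has-deg2 v = 1 ⊓ deg2-neighbours v

  cap : V → ℕ
  cap v = capacity (deg G v) (has-deg2 v)

  module _ (c : PartialColoring) where

    colour-count : V → C → ℕ
    colour-count v α = ∑[ w < n ] ⟦ has α (c v w) ⟧

    coloured : V → ℕ
    coloured v = ∑[ w < n ] ⟦ is-just (c v w) ⟧

    full : V → ℕ
    full v = ∑[ α < 8 ] ⟦ cap v ≤ᵇ colour-count v α ⟧

    -- Given edges ab and yz, the path b - a - y - z has a middle edge whose other edges must differ in colour.
    far : V → V → V → V → Bool
    far a b y z = (not (y == b) ∧ adj G a y) ∧ ((deg G a + deg G y ≤ᵇ 5) ∧ not (z == a))

    far-count : V → V → C → ℕ
    far-count a b α = ∑[ y < n ] ∑[ z < n ] ⟦ far a b y z ∧ has α (c y z) ⟧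

    far-blocked : V → V → ℕ
    far-blocked a b = ∑[ α < 8 ] ⟦ 1 ≤ᵇ far-count a b α ⟧

    -- Summing the colour counts over all colours counts each coloured edge at `v` once, and each
    -- full colour uses at least `cap v` of these edges.
    cap*full≤coloured : ∀ v → cap v * full v ≤ coloured v
    cap*full≤coloured v = begin
      cap v * full v                                   ≤⟨ many-large (cap v) (colour-count v) ⟩
      ∑[ α < 8 ] ∑[ w < n ] ⟦ has α (c v w) ⟧          ≡⟨ ∑-comm {8} {n} (λ α w → ⟦ has α (c v w) ⟧) ⟩
      ∑[ w < n ] ∑[ α < 8 ] ⟦ has α (c v w) ⟧          ≡⟨ sum-cong-≗ {n} (λ w → sum-has true (c v w)) ⟩
      coloured v                                       ∎
      where open ≤-Reasoning

    -- Every forbidden colour is carried by some coloured far edge, and one edge carries only one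
    -- colour.
    far-blocked≤ : ∀ a b → far-blocked a b ≤ ∑[ y < n ] ∑[ z < n ] ⟦ far a b y z ∧ is-just (c y z) ⟧
    far-blocked≤ a b = begin
      far-blocked a b ≡⟨ *-identityˡ (far-blocked a b) ⟨
      1 * far-blocked a b ≤⟨ many-large 1 (far-count a b) ⟩
      ∑[ α < 8 ] ∑[ y < n ] ∑[ z < n ] ⟦ far a b y z ∧ has α (c y z) ⟧
        ≡⟨ ∑-comm {8} {n} (λ α y → ∑[ z < n ] ⟦ far a b y z ∧ has α (c y z) ⟧) ⟩
      ∑[ y < n ] ∑[ α < 8 ] ∑[ z < n ] ⟦ far a b y z ∧ has α (c y z) ⟧
        ≡⟨ sum-cong-≗ {n} (λ y → ∑-comm {8} {n} (λ α z → ⟦ far a b y z ∧ has α (c y z) ⟧)) ⟩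
      ∑[ y < n ] ∑[ z < n ] ∑[ α < 8 ] ⟦ far a b y z ∧ has α (c y z) ⟧
        ≡⟨ sum-cong-≗ {n} (λ y → sum-cong-≗ {n} (λ z → sum-has (far a b y z) (c y z))) ⟩
      ∑[ y < n ] ∑[ z < n ] ⟦ far a b y z ∧ is-just (c y z) ⟧ ∎
      where open ≤-Reasoning

  -- The invariant of the greedy colouring.

  -- Here `proper` only says that non-edges carry no colour; adjacent edges may share one. In
  -- `separated` the case `z = b` is allowed, so triangles are covered too.
  record Good (c : PartialColoring) : Set where
    field
      symmetric : ∀ u v → c u v ≡ c v u
      proper    : ∀ {u v α} → c u v ≡ just α → T (adj G u v)
      capped    : ∀ v α → colour-count c v α ≤ cap v
      separated : ∀ {b a y z α} → deg G a + deg G y ≤ 5 → T (adj G a y) → b ≢ y → z ≢ a →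
                  c b a ≡ just α → c y z ≢ just α
  open Good

  coloured⇒adj : ∀ {c u v} → Good c → T (is-just (c u v)) → T (adj G u v)
  coloured⇒adj {c} {u} {v} good h with c u v in eq
  ... | just α = proper good eq

  -- There are `deg G a ∸ 1` choices for the vertex `y`, and `deg G a + deg G y ≤ 5` leaves at most
  -- `4 ∸ deg G a` edges from `y` away from `a`.
  far-blocked-bound : ∀ {c a b} → Good c → T (adj G a b) →
                      far-blocked c a b ≤ (deg G a ∸ 1) * (4 ∸ deg G a)
  far-blocked-bound {c} {a} {b} good ab = begin
    far-blocked c a b ≤⟨ far-blocked≤ c a b ⟩
    ∑[ y < n ] ∑[ z < n ] ⟦ far c a b y z ∧ is-just (c y z) ⟧ ≤⟨ sum-mono {n} row ⟩
    ∑[ y < n ] (⟦ not (y == b) ∧ adj G a y ⟧ * (4 ∸ deg G a))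
      ≡⟨ *-distribʳ-sum {n} (4 ∸ deg G a) (λ y → ⟦ not (y == b) ∧ adj G a y ⟧) ⟨
    ∑[ y < n ] ⟦ not (y == b) ∧ adj G a y ⟧ * (4 ∸ deg G a) ≡⟨ cong (λ d → (d ∸ 1) * (4 ∸ deg G a)) (deg-remove ab) ⟩
    (deg G a ∸ 1) * (4 ∸ deg G a) ∎
    where
    open ≤-Reasoning
    row : ∀ y → ∑[ z < n ] ⟦ far c a b y z ∧ is-just (c y z) ⟧ ≤ ⟦ not (y == b) ∧ adj G a y ⟧ * (4 ∸ deg G a)
    row y with not (y == b) ∧ adj G a y in eq
    ... | false = ≤-reflexive (sum-zero {n} (λ _ → refl))
    ... | true with deg G a + deg G y ≤ᵇ 5 in small
    ...   | false = ≤-trans (≤-reflexive (sum-zero {n} (λ _ → refl))) z≤n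
    ...   | true  = begin
      ∑[ z < n ] ⟦ not (z == a) ∧ is-just (c y z) ⟧
        ≤⟨ sum-mono {n} (λ z → ⟦⟧-mono (λ h → T-∧⁺ (proj₁ (T-∧⁻ {not (z == a)} h)) (coloured⇒adj good (proj₂ (T-∧⁻ {not (z == a)} h))))) ⟩
      ∑[ z < n ] ⟦ not (z == a) ∧ adj G y z ⟧ ≤⟨ m+n≤o⇒m≤o∸n _ (begin
        _ + deg G a       ≡⟨ +-comm _ (deg G a) ⟩
        deg G a + _       ≤⟨ s≤s⁻¹ (≤-trans (≤-reflexive (trans (sym (+-suc (deg G a) _)) (cong (deg G a +_) (deg-remove (flip-adj ay))))) (≤ᵇ⇒≤ (deg G a + deg G y) 5 (≡-T small))) ⟩
        4                 ∎) ⟩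
      4 ∸ deg G a ≡⟨ *-identityˡ (4 ∸ deg G a) ⟨
      1 * (4 ∸ deg G a) ∎
      where
      ay : T (adj G a y)
      ay = proj₂ (T-∧⁻ {not (y == b)} (≡-T eq))

  -- Colouring one more edge.

  joins : V → V → V → V → Bool
  joins a b u v = ((u == a) ∧ (v == b)) ∨ ((u == b) ∧ (v == a))

  joins⇒≡ : ∀ {a b u v} → T (joins a b u v) → (u ≡ a × v ≡ b) ⊎ (u ≡ b × v ≡ a)
  joins⇒≡ {a} {b} {u} {v} h with Equivalence.to (T-∨ {(u == a) ∧ (v == b)}) h
  ... | inj₁ k = let p , q = T-∧⁻ {u == a} k in inj₁ (==⇒≡ p , ==⇒≡ q)
  ... | inj₂ k = let p , q = T-∧⁻ {u == b} k in inj₂ (==⇒≡ p , ==⇒≡ q)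

  joins-sym : ∀ a b u v → joins a b u v ≡ joins a b v u
  joins-sym a b u v = trans (∨-comm ((u == a) ∧ (v == b)) _) (cong₂ _∨_ (∧-comm (u == b) _) (∧-comm (u == a) _))

  joins-refl : ∀ a b → T (joins a b a b)
  joins-refl a b = Equivalence.from T-∨ (inj₁ (T-∧⁺ (==-refl a) (==-refl b)))

  insert : V → V → C → PartialColoring → PartialColoring
  insert a b α c u v = if joins a b u v then just α else c u v

  module _ {c : PartialColoring} {a b : V} {α : C} (good : Good c) (ab : T (adj G a b))
           (a-free : colour-count c a α < cap a) (b-free : colour-count c b α < cap b)
           (a-far : far-count c a b α ≡ 0) (b-far : far-count c b a α ≡ 0) where

    private
      c′ = insert a b α c

      insert-cases : ∀ {u v β} → c′ u v ≡ just β →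
                     (β ≡ α × ((u ≡ a × v ≡ b) ⊎ (u ≡ b × v ≡ a))) ⊎ c u v ≡ just β
      insert-cases {u} {v} eq with joins a b u v in j
      ... | true  = inj₁ (sym (just-injective eq) , joins⇒≡ (≡-T j))
      ... | false = inj₂ eq

      count-unchanged : ∀ {v β} → β ≡ α × (v ≡ a ⊎ v ≡ b) ⊎ colour-count c′ v β ≤ colour-count c v β
      count-unchanged {v} {β} with β ≟ α | v ≟ a | v ≟ b
      ... | yes p | yes q | _     = inj₁ (p , inj₁ q)
      ... | yes p | no _  | yes r = inj₁ (p , inj₂ r)
      ... | no β≢α | _ | _ = inj₂ (sum-mono {n} (λ w → ⟦⟧-mono (λ h → case insert-cases {v} {w} (has⇒≡ h) of λ where
              (inj₁ (β≡α , _)) → ⊥-elim (β≢α β≡α)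
              (inj₂ eq)        → ≡⇒has eq)))
      ... | yes _ | no v≢a | no v≢b = inj₂ (sum-mono {n} (λ w → ⟦⟧-mono (λ h → case insert-cases {v} {w} (has⇒≡ h) of λ where
              (inj₁ (_ , inj₁ (v≡a , _))) → ⊥-elim (v≢a v≡a)
              (inj₁ (_ , inj₂ (v≡b , _))) → ⊥-elim (v≢b v≡b)
              (inj₂ eq)                   → ≡⇒has eq)))

      -- At an end of the new edge only the entry of the opposite end `x` is affected, so the strict
      -- inequality at a colour that is not full absorbs the change.
      count-step : ∀ v x {β} → (∀ {w} → c′ v w ≡ just β → w ≡ x ⊎ c v w ≡ just β) →
                   colour-count c′ v β ≤ suc (colour-count c v β)
      count-step v x {β} h = begin
        colour-count c′ v β ≤⟨ sum-mono {n} (λ w → ⟦⟧≤+ {has β (c′ v w)} {w == x} (λ k → case h {w} (has⇒≡ k) of λ where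
          (inj₁ w≡x) → inj₁ (≡⇒== w≡x)
          (inj₂ eq)  → inj₂ (≡⇒has eq))) ⟩
        ∑[ w < n ] (⟦ w == x ⟧ + ⟦ has β (c v w) ⟧) ≡⟨ ∑-distrib-+ {n} (λ w → ⟦ w == x ⟧) (λ w → ⟦ has β (c v w) ⟧) ⟩
        ∑[ w < n ] ⟦ w == x ⟧ + colour-count c v β  ≡⟨ cong (_+ colour-count c v β) (sum-indicator x) ⟩
        suc (colour-count c v β) ∎
        where open ≤-Reasoning

      not-far : ∀ {a b} → far-count c a b α ≡ 0 → ∀ {y z} →
                deg G a + deg G y ≤ 5 → T (adj G a y) → b ≢ y → z ≢ a → c y z ≢ just α
      not-far {a} {b} none {y} {z} small ay b≢y z≢a eq = <-irrefl (sym none) (begin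
        1                                       ≤⟨ ⟦⟧-mono {true} (λ _ → T-∧⁺ (T-∧⁺ (T-∧⁺ (≢⇒≠ (b≢y ∘ sym)) ay) (T-∧⁺ (≤⇒≤ᵇ small) (≢⇒≠ z≢a))) (≡⇒has eq)) ⟩
        ⟦ far c a b y z ∧ has α (c y z) ⟧        ≤⟨ term≤sum (λ z → ⟦ far c a b y z ∧ has α (c y z) ⟧) z ⟩
        ∑[ z < n ] ⟦ far c a b y z ∧ has α (c y z) ⟧ ≤⟨ term≤sum (λ y → ∑[ z < n ] ⟦ far c a b y z ∧ has α (c y z) ⟧) y ⟩
        far-count c a b α                       ∎)
        where open ≤-Reasoning

      a≢b : a ≢ b
      a≢b = adj⇒≢ ab

    insert-good : Good c′
    insert-good .symmetric u v rewrite joins-sym a b u v with joins a b v u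
    ... | true  = refl
    ... | false = symmetric good u v
    insert-good .proper {u} {v} eq with insert-cases {u} {v} eq
    ... | inj₁ (_ , inj₁ (refl , refl)) = ab
    ... | inj₁ (_ , inj₂ (refl , refl)) = flip-adj ab
    ... | inj₂ old                      = proper good old
    insert-good .capped v β with count-unchanged {v} {β}
    ... | inj₂ le = ≤-trans le (capped good v β)
    ... | inj₁ (refl , inj₁ refl) = ≤-trans (count-step a b (λ {w} eq → case insert-cases {a} {w} eq of λ where
            (inj₁ (_ , inj₁ (_ , w≡b))) → inj₁ w≡b
            (inj₁ (_ , inj₂ (a≡b , _))) → ⊥-elim (a≢b a≡b)
            (inj₂ old)                  → inj₂ old)) a-free
    ... | inj₁ (refl , inj₂ refl) = ≤-trans (count-step b a (λ {w} eq → case insert-cases {b} {w} eq of λ where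
            (inj₁ (_ , inj₁ (b≡a , _))) → ⊥-elim (a≢b (sym b≡a))
            (inj₁ (_ , inj₂ (_ , w≡a))) → inj₁ w≡a
            (inj₂ old)                  → inj₂ old)) b-free
    insert-good .separated {t} {x} {y} {z} small xy t≢y z≢x eq₁ eq₂
      with insert-cases {t} {x} eq₁ | insert-cases {y} {z} eq₂
    ... | inj₂ old₁ | inj₂ old₂ = separated good small xy t≢y z≢x old₁ old₂
    ... | inj₁ (refl , inj₁ (refl , refl)) | inj₂ old = not-far b-far small xy t≢y z≢x old
    ... | inj₁ (refl , inj₂ (refl , refl)) | inj₂ old = not-far a-far small xy t≢y z≢x old
    -- With the new edge at the end of the path, the path is read backwards, exchanging its two
    -- middle vertices.
    ... | inj₂ old | inj₁ (refl , inj₁ (refl , refl)) =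
      not-far a-far (subst (_≤ 5) (+-comm (deg G x) _) small) (flip-adj xy) z≢x t≢y (trans (symmetric good x t) old)
    ... | inj₂ old | inj₁ (refl , inj₂ (refl , refl)) =
      not-far b-far (subst (_≤ 5) (+-comm (deg G x) _) small) (flip-adj xy) z≢x t≢y (trans (symmetric good x t) old)
    -- The new edge cannot be both outer edges: that would force `t = y` or a loop `x = y`.
    ... | inj₁ (refl , inj₁ (refl , refl)) | inj₁ (_ , inj₁ (refl , _)) = t≢y refl
    ... | inj₁ (refl , inj₁ (refl , refl)) | inj₁ (_ , inj₂ (refl , _)) = adj⇒≢ xy refl
    ... | inj₁ (refl , inj₂ (refl , refl)) | inj₁ (_ , inj₁ (refl , _)) = adj⇒≢ xy refl
    ... | inj₁ (refl , inj₂ (refl , refl)) | inj₁ (_ , inj₂ (refl , _)) = t≢y refl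

  infix 4 _⊑_
  _⊑_ : PartialColoring → PartialColoring → Set
  c ⊑ c′ = ∀ u v → T (is-just (c u v)) → T (is-just (c′ u v))

  ⊑-insert : ∀ {a b α c} → c ⊑ insert a b α c
  ⊑-insert {a} {b} u v h with joins a b u v
  ... | true  = tt
  ... | false = h

  coloured-insert : ∀ a b {α c} → T (is-just (insert a b α c a b))
  coloured-insert a b rewrite Equivalence.to T-≡ (joins-refl a b) = tt

  extend : ∀ {c a b} → Good c → T (adj G a b) →
           (full c a + far-blocked c a b) + (full c b + far-blocked c b a) < 8 →
           ∃[ α ] Good (insert a b α c)
  extend {c} {a} {b} good ab few =
    let α , (a-free , a-far) , (b-free , b-far) =
          sum-avoid₄ (λ α → cap a ≤ᵇ colour-count c a α) (λ α → 1 ≤ᵇ far-count c a b α)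
                     (λ α → cap b ≤ᵇ colour-count c b α) (λ α → 1 ≤ᵇ far-count c b a α) few
    in α , insert-good good ab (≰ᵇ⇒> a-free) (≰ᵇ⇒> b-free) (n<1⇒n≡0 (≰ᵇ⇒> a-far)) (n<1⇒n≡0 (≰ᵇ⇒> b-far))
    where
    ≰ᵇ⇒> : ∀ {k m} → ¬ T (k ≤ᵇ m) → m < k
    ≰ᵇ⇒> h = ≰⇒> (h ∘ ≤⇒≤ᵇ)

  -- Bounds on the forbidden colours in the two passes.

  -- The coloured edges at `a`, the edge `ab` and the edges selected by `p` are pairwise disjoint
  -- sets of edges at `a`.
  coloured-bound : ∀ {c a b} → Good c → T (adj G a b) → ¬ T (is-just (c a b)) → (p : V → Bool) →
                   (∀ {w} → T (p w) → T (adj G a w) × ¬ T (is-just (c a w)) × w ≢ b) →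
                   coloured c a + suc (∑[ w < n ] ⟦ p w ⟧) ≤ deg G a
  coloured-bound {c} {a} {b} good ab new p p-ok = begin
    coloured c a + suc (∑[ w < n ] ⟦ p w ⟧)
      ≡⟨ cong (λ s → coloured c a + (s + ∑[ w < n ] ⟦ p w ⟧)) (sum-indicator b) ⟨
    coloured c a + (∑[ w < n ] ⟦ w == b ⟧ + ∑[ w < n ] ⟦ p w ⟧)
      ≡⟨ cong (coloured c a +_) (∑-distrib-+ {n} (λ w → ⟦ w == b ⟧) (λ w → ⟦ p w ⟧)) ⟨
    coloured c a + ∑[ w < n ] (⟦ w == b ⟧ + ⟦ p w ⟧)
      ≡⟨ ∑-distrib-+ {n} (λ w → ⟦ is-just (c a w) ⟧) (λ w → ⟦ w == b ⟧ + ⟦ p w ⟧) ⟨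
    ∑[ w < n ] (⟦ is-just (c a w) ⟧ + (⟦ w == b ⟧ + ⟦ p w ⟧))
      ≤⟨ sum-mono {n} (λ w → ⟦⟧-disjoint {is-just (c a w)} {w == b} {p w}
           (λ old w≡b → new (subst (T ∘ is-just ∘ c a) (==⇒≡ w≡b) old))
           (λ old pw → proj₁ (proj₂ (p-ok pw)) old)
           (λ w≡b pw → proj₂ (proj₂ (p-ok pw)) (==⇒≡ w≡b))
           (coloured⇒adj good)
           (λ w≡b → subst (T ∘ adj G a) (sym (==⇒≡ w≡b)) ab)
           (λ pw → proj₁ (p-ok pw))) ⟩
    ∑[ w < n ] ⟦ adj G a w ⟧ ≡⟨ deg-sum a ⟨
    deg G a ∎
    where open ≤-Reasoning

  coloured<deg : ∀ {c a b} → Good c → T (adj G a b) → ¬ T (is-just (c a b)) → coloured c a < deg G a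
  coloured<deg {c} {a} good ab new =
    ≤-trans (m<m+n (coloured c a) (s≤s z≤n)) (coloured-bound good ab new (λ _ → false) (λ ()))

  flip-coloured : ∀ {c u v} → Good c → T (is-just (c u v)) → T (is-just (c v u))
  flip-coloured {c} {u} {v} good = subst (T ∘ is-just) (symmetric good u v)

  -- Invariant of the first pass; symmetry of the colouring extends it to the second end of an edge.
  Avoids₂ : PartialColoring → Set
  Avoids₂ c = ∀ u v → T (is-just (c u v)) → deg G u ≢ 2

  insert-avoids₂ : ∀ {c a b α} → Avoids₂ c → deg G a ≢ 2 → deg G b ≢ 2 → Avoids₂ (insert a b α c)
  insert-avoids₂ {c} {a} {b} av a≢2 b≢2 u v h with joins a b u v in j
  ... | false = av u v h
  ... | true with joins⇒≡ {a} {b} {u} {v} (≡-T j)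
  ...   | inj₁ (refl , _) = a≢2
  ...   | inj₂ (refl , _) = b≢2

  side₁≤3 : ∀ {c a b} → Good c → Avoids₂ c → T (adj G a b) → ¬ T (is-just (c a b)) →
            deg G a ≢ 2 → deg G b ≢ 2 → full c a + far-blocked c a b ≤ 3
  side₁≤3 {c} {a} {b} good av ab new a≢2 b≢2 = begin
    full c a + far-blocked c a b ≡⟨ cong (full c a +_) no-far ⟩
    full c a + 0                 ≡⟨ +-identityʳ (full c a) ⟩
    full c a                     ≤⟨ full≤3 {deg G a} {has-deg2 a} (cap*full≤coloured c a) enough ⟩
    3                            ∎
    where
    open ≤-Reasoning
    enough : coloured c a + suc (has-deg2 a) ≤ deg G a
    -- In the first pass an edge from `a` to a vertex of degree 2 is still uncoloured, and it is not
    -- `ab` because `b` has another degree.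
    enough = ≤-trans (+-monoʳ-≤ (coloured c a) (s≤s (m⊓n≤n 1 (deg2-neighbours a))))
      (coloured-bound good ab new (λ w → adj G a w ∧ (deg G w ≡ᵇ 2)) (λ {w} h →
        let aw , w≡2 = T-∧⁻ {adj G a w} h
            w≡2′ = ≡ᵇ⇒≡ (deg G w) 2 w≡2
        in aw , (λ old → av w a (flip-coloured good old) w≡2′) , λ { refl → b≢2 w≡2′ }))
    -- Both middle vertices have two distinct neighbours, hence degree at least 2. Degree 2 is
    -- excluded for `a` by hypothesis and for `y` because `yz` is already coloured, so the degree
    -- sum is at least 6.
    impossible : ∀ {y z} → ¬ T (far c a b y z ∧ is-just (c y z))
    impossible {y} {z} h =
      let f , old = T-∧⁻ {far c a b y z} h
          g , k = T-∧⁻ {not (y == b) ∧ adj G a y} f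
          y≠b , ay = T-∧⁻ {not (y == b)} g
          small , z≠a = T-∧⁻ {deg G a + deg G y ≤ᵇ 5} k
          a≥3 = ≤∧≢⇒< (deg≥2 ab ay (≠⇒≢ y≠b)) (a≢2 ∘ sym)
          y≥3 = ≤∧≢⇒< (deg≥2 (flip-adj ay) (coloured⇒adj good old) (≠⇒≢ z≠a)) (av y z old ∘ sym)
      in <⇒≱ (+-mono-≤ a≥3 y≥3) (≤ᵇ⇒≤ (deg G a + deg G y) 5 small)
    no-far : far-blocked c a b ≡ 0
    no-far = n≤0⇒n≡0 (≤-trans (far-blocked≤ c a b) (≤-reflexive
      (sum-zero {n} (λ y → sum-zero {n} (λ z → ¬T⇒0 (impossible {y} {z}))))))

  side₂≤4 : ∀ {c a b} → Good c → T (adj G a b) → ¬ T (is-just (c a b)) →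
            full c a + far-blocked c a b ≤ 4
  side₂≤4 {c} {a} good ab new = side≤4 (deg G a)
    (full≤4 {deg G a} {has-deg2 a} (m⊓n≤m 1 _) (cap*full≤coloured c a) (coloured<deg good ab new))
    (full<deg {deg G a} {has-deg2 a} (cap*full≤coloured c a) (coloured<deg good ab new))
    (far-blocked-bound good ab)

  -- At degree 2 at most one colour is full, and at most `(2 ∸ 1) * (4 ∸ 2) = 2` colours are
  -- forbidden by far edges.
  side₂≤3 : ∀ {c a b} → Good c → T (adj G a b) → ¬ T (is-just (c a b)) → deg G a ≡ 2 →
            full c a + far-blocked c a b ≤ 3
  side₂≤3 {c} {a} good ab new a≡2 = side≤3 a≡2
    (full<deg {deg G a} {has-deg2 a} (cap*full≤coloured c a) (coloured<deg good ab new))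
    (far-blocked-bound good ab)

  -- The two greedy passes over all edges.

  Between₂ : V → V → Set
  Between₂ u v = T (adj G u v) × deg G u ≢ 2 × deg G v ≢ 2

  Covers : (V → V → Set) → PartialColoring → Set
  Covers R c = ∀ u v → R u v → T (is-just (c u v))

  -- The invariant `A` and the edges `R` to be covered are parameters, since both passes run the
  -- same loop. Monotonicity under `⊑` keeps earlier edges coloured.
  sweep : (A : PartialColoring → Set) (R : V → V → Set) →
          (∀ {c} u v → A c → ∃[ c′ ] A c′ × c ⊑ c′ × (R u v → T (is-just (c′ u v)))) →
          ∀ es {c} → A c → ∃[ c′ ] A c′ × c ⊑ c′ × (∀ {u v} → (u , v) ∈ es → R u v → T (is-just (c′ u v)))
  sweep A R step [] Ac = _ , Ac , (λ _ _ h → h) , λ ()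
  sweep A R step ((u , v) ∷ es) Ac =
    let c₁ , Ac₁ , c⊑c₁ , new = step u v Ac
        c₂ , Ac₂ , c₁⊑c₂ , rest = sweep A R step es Ac₁
    in c₂ , Ac₂ , (λ u v → c₁⊑c₂ u v ∘ c⊑c₁ u v) , λ where
      (here refl) r → c₁⊑c₂ u v (new r)
      (there e∈)  r → rest e∈ r

  sweep-all : (A : PartialColoring → Set) (R : V → V → Set) →
              (∀ {c} u v → A c → ∃[ c′ ] A c′ × c ⊑ c′ × (R u v → T (is-just (c′ u v)))) →
              ∀ {c} → A c → ∃[ c′ ] A c′ × Covers R c′
  sweep-all A R step Ac =
    let c′ , Ac′ , _ , covers = sweep A R step (pairs n) Ac
    in c′ , Ac′ , λ u v → covers (∈-cartesianProduct⁺ (∈-allFin u) (∈-allFin v))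

  step₁ : ∀ {c} u v → Good c × Avoids₂ c →
          ∃[ c′ ] (Good c′ × Avoids₂ c′) × c ⊑ c′ × (Between₂ u v → T (is-just (c′ u v)))
  step₁ {c} u v (good , av) with T? (adj G u v) | deg G u ℕ.≟ 2 | deg G v ℕ.≟ 2 | T? (is-just (c u v))
  ... | no ¬uv | _ | _ | _ = c , (good , av) , (λ _ _ h → h) , λ (uv , _) → ⊥-elim (¬uv uv)
  ... | yes _ | yes u≡2 | _ | _ = c , (good , av) , (λ _ _ h → h) , λ (_ , u≢2 , _) → ⊥-elim (u≢2 u≡2)
  ... | yes _ | no _ | yes v≡2 | _ = c , (good , av) , (λ _ _ h → h) , λ (_ , _ , v≢2) → ⊥-elim (v≢2 v≡2)
  ... | yes _ | no _ | no _ | yes old = c , (good , av) , (λ _ _ h → h) , λ _ → old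
  ... | yes uv | no u≢2 | no v≢2 | no new =
    -- At most `3 + 3` colours are forbidden, one fewer than eight colours tolerate.
    let α , good′ = extend good uv (s≤s (≤-trans
          (+-mono-≤ (side₁≤3 good av uv new u≢2 v≢2) (side₁≤3 good av (flip-adj uv) (new ∘ flip-coloured good) v≢2 u≢2))
          (n≤1+n 6)))
    in insert u v α c , (good′ , insert-avoids₂ av u≢2 v≢2) , ⊑-insert {c = c} , λ _ → coloured-insert u v {c = c}

  step₂ : ∀ {c} u v → Good c × Covers Between₂ c →
          ∃[ c′ ] (Good c′ × Covers Between₂ c′) × c ⊑ c′ × (T (adj G u v) → T (is-just (c′ u v)))
  step₂ {c} u v (good , covers) with T? (adj G u v) | T? (is-just (c u v))
  ... | no ¬uv | _ = c , (good , covers) , (λ _ _ h → h) , λ uv → ⊥-elim (¬uv uv)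
  ... | yes _ | yes old = c , (good , covers) , (λ _ _ h → h) , λ _ → old
  ... | yes uv | no new =
    let α , good′ = extend good uv (s≤s few)
    in insert u v α c , (good′ , λ x y r → ⊑-insert {c = c} x y (covers x y r)) , ⊑-insert {c = c} , λ _ → coloured-insert u v {c = c}
    where
    vu : T (adj G v u)
    vu = flip-adj uv
    new′ : ¬ T (is-just (c v u))
    new′ = new ∘ flip-coloured good
    few : (full c u + far-blocked c u v) + (full c v + far-blocked c v u) ≤ 7
    -- An edge left uncoloured by the first pass has an end of degree 2, so the count is
    -- `3 + 4 = 7`, leaving one of the eight colours.
    few with deg G u ℕ.≟ 2 | deg G v ℕ.≟ 2
    ... | yes u≡2 | _       = +-mono-≤ (side₂≤3 good uv new u≡2) (side₂≤4 good vu new′)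
    ... | no _    | yes v≡2 = +-mono-≤ (side₂≤4 good uv new) (side₂≤3 good vu new′ v≡2)
    ... | no u≢2  | no v≢2  = ⊥-elim (new (covers u v (uv , u≢2 , v≢2)))

  uncoloured : PartialColoring
  uncoloured _ _ = nothing

  uncoloured-good : Good uncoloured
  uncoloured-good = record
    { symmetric = λ _ _ → refl
    ; proper    = λ ()
    ; capped    = λ v α → ≤-trans (≤-reflexive (sum-zero {n} (λ _ → refl))) z≤n
    ; separated = λ _ _ _ _ ()
    }

  good-coloring : ∃[ c ] Good c × Covers (λ u v → T (adj G u v)) c
  good-coloring =
    let c₁ , (good₁ , _) , covers₁ = sweep-all (λ c → Good c × Avoids₂ c) Between₂ step₁ (uncoloured-good , λ _ _ ())
        c₂ , (good₂ , _) , covers₂ = sweep-all (λ c → Good c × Covers Between₂ c) (λ u v → T (adj G u v)) step₂ (good₁ , covers₁)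
    in c₂ , good₂ , covers₂

  -- The majority condition for a total good colouring.

  module _ (adm : Admissible G) {c : PartialColoring} (good : Good c)
           (total : Covers (λ u v → T (adj G u v)) c) (α : C) where

    private
      others : V → V → ℕ
      others a b = ∑[ w < n ] ⟦ not (w == b) ∧ adj G a w ⟧

      repeats : V → V → ℕ
      repeats a b = ∑[ w < n ] ⟦ not (w == b) ∧ has α (c a w) ⟧

      repeats≤others : ∀ a b → repeats a b ≤ others a b
      repeats≤others a b = sum-mono {n} (λ w → ⟦⟧-mono (λ h →
        let p , q = T-∧⁻ {not (w == b)} h in T-∧⁺ p (proper good (has⇒≡ q))))

      repeats≤cap : ∀ a b → repeats a b ≤ cap a
      repeats≤cap a b = ≤-trans
        (sum-mono {n} (λ w → ⟦⟧-mono (λ h → proj₂ (T-∧⁻ {not (w == b)} h)))) (capped good a α)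

      degree-sum : ∀ {a b} → T (adj G a b) → deg G a + deg G b ≡ 2 + (others a b + others b a)
      degree-sum {a} {b} ab = trans (sym (cong₂ _+_ (deg-remove ab) (deg-remove (flip-adj ab))))
                                    (cong suc (+-suc (others a b) (others b a)))

      swap-bound : ∀ {a b} → 2 * (repeats b a + repeats a b) ≤ others b a + others a b →
                   2 * (repeats a b + repeats b a) ≤ others a b + others b a
      swap-bound {a} {b} = subst₂ _≤_ (cong (2 *_) (+-comm (repeats b a) _)) (+-comm (others b a) _)

      few-others : ∀ {a b k} → T (adj G a b) → deg G b ≤ suc k → others b a ≤ k
      few-others ab b≤ = s≤s⁻¹ (≤-trans (≤-reflexive (deg-remove (flip-adj ab))) b≤)

      large-half : ∀ {a b} → T (adj G a b) → 3 ≤ deg G a → 2 * repeats a b ≤ others a b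
      large-half {a} {b} ab a≥3 = s≤s⁻¹ (begin-strict
        2 * repeats a b  ≤⟨ *-monoʳ-≤ 2 (repeats≤cap a b) ⟩
        2 * cap a        <⟨ 2*capacity< (has-deg2 a) a≥3 ⟩
        deg G a          ≡⟨ deg-remove ab ⟨
        suc (others a b) ∎)
        where open ≤-Reasoning

      large-large : ∀ {a b} → T (adj G a b) → 3 ≤ deg G a → 3 ≤ deg G b →
                    2 * (repeats a b + repeats b a) ≤ others a b + others b a
      large-large {a} {b} ab a≥3 b≥3 = ≤-trans (≤-reflexive (*-distribˡ-+ 2 (repeats a b) (repeats b a)))
        (+-mono-≤ (large-half ab a≥3) (large-half (flip-adj ab) b≥3))

      has-deg2≡1 : ∀ {a b} → T (adj G a b) → deg G b ≡ 2 → has-deg2 a ≡ 1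
      has-deg2≡1 {a} {b} ab b≡2 = m≤n⇒m⊓n≡m (≤-trans
        (⟦⟧-mono {true} (λ _ → T-∧⁺ ab (≡⇒≡ᵇ (deg G b) 2 b≡2)))
        (term≤sum (λ w → ⟦ adj G a w ∧ (deg G w ≡ᵇ 2) ⟧) b))

      -- If `b` has degree 2, then `deg G a` is at least 4, and the lowered cap at `a` makes room
      -- for the one other edge at `b`. If `b` has degree 1, it adds nothing, and `deg G a` is at
      -- least 5.
      large-small : ∀ {a b} → T (adj G a b) → 6 ≤ deg G a + deg G b → deg G b ≤ 2 →
                    2 * (repeats a b + repeats b a) ≤ others a b + others b a
      large-small {a} {b} ab large b≤2 with deg G b ℕ.≟ 2
      ... | yes b≡2 = begin
        2 * (repeats a b + repeats b a) ≤⟨ *-monoʳ-≤ 2 (+-mono-≤ (repeats≤cap a b) (≤-trans (repeats≤others b a) (few-others ab b≤2))) ⟩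
        2 * (cap a + 1)                 ≡⟨ cong (2 *_) (+-comm (cap a) 1) ⟩
        2 * (1 + cap a)                 ≡⟨ *-distribˡ-+ 2 1 (cap a) ⟩
        2 + 2 * cap a                   ≡⟨ cong (λ h → 2 + 2 * capacity (deg G a) h) (has-deg2≡1 ab b≡2) ⟩
        2 + 2 * capacity (deg G a) 1    ≤⟨ 2+2*capacity≤ a≥4 ⟩
        deg G a                         ≡⟨ deg≡ ⟩
        others a b + others b a         ∎
        where
        open ≤-Reasoning
        a≥4 : 4 ≤ deg G a
        a≥4 = +-cancelʳ-≤ 2 4 (deg G a) (subst (λ d → 6 ≤ deg G a + d) b≡2 large)
        deg≡ : deg G a ≡ others a b + others b a
        deg≡ = +-cancelʳ-≡ 2 (deg G a) (others a b + others b a)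
          (trans (trans (cong (deg G a +_) (sym b≡2)) (degree-sum ab)) (+-comm 2 _))
      ... | no b≢2 = begin
        2 * (repeats a b + repeats b a) ≡⟨ cong (λ r → 2 * (repeats a b + r)) (n≤0⇒n≡0 (≤-trans (repeats≤others b a) (few-others ab b≤1))) ⟩
        2 * (repeats a b + 0)           ≡⟨ cong (2 *_) (+-identityʳ (repeats a b)) ⟩
        2 * repeats a b                 ≤⟨ large-half ab (≤-trans (m≤m+n 3 2) a≥5) ⟩
        others a b                      ≤⟨ m≤m+n (others a b) (others b a) ⟩
        others a b + others b a         ∎
        where
        open ≤-Reasoning
        b≤1 : deg G b ≤ 1
        b≤1 = s≤s⁻¹ (≤∧≢⇒< b≤2 b≢2)
        a≥5 : 5 ≤ deg G a
        a≥5 = +-cancelʳ-≤ 1 5 (deg G a) (≤-trans large (+-monoʳ-≤ (deg G a) b≤1))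

      -- Here `deg G a` is at most 4, so the cap is 1 and the colour occurs at most once. One
      -- occurrence is harmless as soon as the edge has two adjacent edges.
      small : ∀ {a b} → T (adj G a b) → deg G a + deg G b ≤ 5 → repeats b a ≡ 0 →
              2 * (repeats a b + repeats b a) ≤ others a b + others b a
      small {a} {b} ab sum≤5 none rewrite none | +-identityʳ (repeats a b) with repeats a b in p | others a b in s | others b a in t
      ... | zero        | _           | _     = z≤n
      ... | suc zero    | suc (suc _) | _     = s≤s (s≤s z≤n)
      ... | suc zero    | suc zero    | suc _ = s≤s (s≤s z≤n)
      -- With only one adjacent edge, `b` has degree 1 and `a` degree 2; this is where admissibility
      -- enters.
      ... | suc zero    | suc zero    | zero  = ⊥-elim (adm b a (flip-adj ab)
              (trans (sym (deg-remove (flip-adj ab))) (cong suc t)) (trans (sym (deg-remove ab)) (cong suc s)))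
      ... | suc zero    | zero        | _     = ⊥-elim (<⇒≱ (s≤s z≤n) (subst₂ _≤_ p s (repeats≤others a b)))
      ... | suc (suc _) | _           | _     = ⊥-elim (<⇒≱ (s≤s (s≤s z≤n)) (subst (_≤ 1) p
              (≤-trans (repeats≤cap a b) (capacity≤1 (has-deg2 a) a≤4))))
        where
        a≤4 : deg G a ≤ 4
        a≤4 = s≤s⁻¹ (≤-trans (subst (_≤ deg G a + deg G b) (+-comm (deg G a) 1)
          (+-monoʳ-≤ (deg G a) (subst (1 ≤_) (deg-remove (flip-adj ab)) (s≤s z≤n)))) sum≤5)

      -- Repeats at both ends would be equally coloured outer edges of `w - a - b - z`, against
      -- `separated`.
      not-both : ∀ {a b} → T (adj G a b) → deg G a + deg G b ≤ 5 → 1 ≤ repeats a b → ¬ 1 ≤ repeats b a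
      not-both {a} {b} ab sum≤5 p q =
        let w , h = sum-witness (λ w → not (w == b) ∧ has α (c a w)) p
            z , k = sum-witness (λ z → not (z == a) ∧ has α (c b z)) q
            w≠b , aw = T-∧⁻ {not (w == b)} h
            z≠a , bz = T-∧⁻ {not (z == a)} k
        in separated good sum≤5 ab (≠⇒≢ w≠b) (≠⇒≢ z≠a) (trans (symmetric good w a) (has⇒≡ aw)) (has⇒≡ bz)

    -- For degree sum at least 6 the caps suffice. Below that, separation confines the colour to one
    -- end, and the cap 1 there suffices.
    repeats-bound : ∀ {a b} → T (adj G a b) →
      2 * (∑[ w < n ] ⟦ not (w == b) ∧ has α (c a w) ⟧ + ∑[ w < n ] ⟦ not (w == a) ∧ has α (c b w) ⟧) ≤
      ∑[ w < n ] ⟦ not (w == b) ∧ adj G a w ⟧ + ∑[ w < n ] ⟦ not (w == a) ∧ adj G b w ⟧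
    repeats-bound {a} {b} ab with deg G a + deg G b ≤? 5
    ... | no ≰5 with deg G b ≤? 2 | deg G a ≤? 2
    ...   | yes b≤2 | _       = large-small ab (≰⇒> ≰5) b≤2
    ...   | no _    | yes a≤2 = swap-bound (large-small (flip-adj ab) (subst (6 ≤_) (+-comm (deg G a) _) (≰⇒> ≰5)) a≤2)
    ...   | no b≰2  | no a≰2  = large-large ab (≰⇒> a≰2) (≰⇒> b≰2)
    repeats-bound {a} {b} ab | yes ≤5 with repeats a b ℕ.≟ 0
    ... | yes p≡0 = swap-bound (small (flip-adj ab) (subst (_≤ 5) (+-comm (deg G a) _) ≤5) p≡0)
    ... | no p≢0 = small ab ≤5 (n<1⇒n≡0 (≰⇒> (not-both ab ≤5 (n≢0⇒n>0 p≢0))))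

  -- Passing to a total edge-colouring.

  -- Once every edge is coloured, the default `zero` is taken only at non-edges, where the value is
  -- irrelevant.
  toColoring : PartialColoring → EdgeColoring n 8
  toColoring c u v = fromMaybe zero (c u v)

  has-toColoring : ∀ {c α} u v → T (is-just (c u v)) → T (toColoring c u v == α) → T (has α (c u v))
  has-toColoring {c} {α} u v h eq with c u v
  ... | just β = ≡⇒== (sym (==⇒≡ {u = β} {v = α} eq))

  strong-majority : Admissible G → ∀ {c} → Good c → Covers (λ u v → T (adj G u v)) c →
                    StrongMajority G (toColoring c)
  strong-majority adm {c} good total a b e α = begin
    2 * nAdjCol G (toColoring c) (a , b) α
      ≡⟨ cong (2 *_) (countB-pairs {n} _) ⟩
    2 * ∑[ u < n ] ∑[ v < n ] ⟦ isEdge G (u , v) ∧ (adjacentTo (a , b) (u , v) ∧ (toColoring c u v == α)) ⟧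
      ≤⟨ *-monoʳ-≤ 2 (sum-mono {n} (λ u → sum-mono {n} (λ v → ⟦⟧-mono (reorder u v)))) ⟩
    2 * ∑[ u < n ] ∑[ v < n ] ⟦ ((toℕ u <ᵇ toℕ v) ∧ has α (c u v)) ∧ adjacentTo (a , b) (u , v) ⟧
      ≡⟨ cong (2 *_) (pairs-adjacent (λ u v → has α (c u v)) (λ u v → cong (has α) (symmetric good u v)) no-loop a b a<b) ⟩
    2 * (∑[ w < n ] ⟦ not (w == b) ∧ has α (c a w) ⟧ + ∑[ w < n ] ⟦ not (w == a) ∧ has α (c b w) ⟧)
      ≤⟨ repeats-bound adm good total α ab ⟩
    ∑[ w < n ] ⟦ not (w == b) ∧ adj G a w ⟧ + ∑[ w < n ] ⟦ not (w == a) ∧ adj G b w ⟧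
      ≡⟨ pairs-adjacent (adj G) (adj-sym G) (adj-irrefl G) a b a<b ⟨
    ∑[ u < n ] ∑[ v < n ] ⟦ isEdge G (u , v) ∧ adjacentTo (a , b) (u , v) ⟧
      ≡⟨ countB-pairs {n} (λ f → isEdge G f ∧ adjacentTo (a , b) f) ⟨
    nAdj G (a , b) ∎
    where
    open ≤-Reasoning
    a<b : toℕ a < toℕ b
    a<b = <ᵇ⇒< (toℕ a) (toℕ b) (proj₁ (T-∧⁻ {toℕ a <ᵇ toℕ b} e))
    ab : T (adj G a b)
    ab = proj₂ (T-∧⁻ {toℕ a <ᵇ toℕ b} e)
    no-loop : ∀ v → has α (c v v) ≡ false
    no-loop v with has α (c v v) in eq
    ... | false = refl
    ... | true  = ⊥-elim (adj⇒≢ (proper good (has⇒≡ {m = c v v} (≡-T eq))) refl)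
    reorder : ∀ u v → T (isEdge G (u , v) ∧ (adjacentTo (a , b) (u , v) ∧ (toColoring c u v == α))) →
              T (((toℕ u <ᵇ toℕ v) ∧ has α (c u v)) ∧ adjacentTo (a , b) (u , v))
    reorder u v h =
      let edge , k    = T-∧⁻ {isEdge G (u , v)} h
          u<v , uv    = T-∧⁻ {toℕ u <ᵇ toℕ v} edge
          near , eq   = T-∧⁻ {adjacentTo (a , b) (u , v)} k
      in T-∧⁺ (T-∧⁺ u<v (has-toColoring {c} u v (total u v uv) eq)) near

theorem8 : (n : ℕ) (G : Graph n) → Admissible G → MajAtMost G 8
theorem8 n G adm =
  let c , good , total = good-coloring G in toColoring G c , strong-majority G adm good total
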